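{- If $n$ is a non-negative integer and $p$ is a non-zero integer, then $$\sum_{k=1}^n(-1)^{n-k}\frac{k}{n+k}\binom{n+k}{n-k}\left(\frac{2L_{2p}}{\sqrt5F_{2p}}\right)^{2k}=(-1)^p\,\frac{L_{2p}\left(L_p^{4n}-5^{2n}F_p^{4n}\right)}{4(\sqrt5F_{2p})^{2n}}.$$
   Context: $F_n$ and $L_n$ ($n\in\mathbb{Z}$) are the Fibonacci and Lucas numbers: $F_0=0$, $F_1=1$, $F_n=F_{n-1}+F_{n-2}$; $L_0=2$, $L_1=1$, $L_n=L_{n-1}+L_{n-2}$, extended to negative indices by $F_{ -n}=(-1)^{n-1}F_n$, $L_{ -n}=(-1)^nL_n$. An empty sum is $0$. -}

module Defs where

open import Algebra.Properties.Group using (x∙y⁻¹≈ε⇒x≈y)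
open import Data.Integer.Base as ℤ using (ℤ; +_; -[1+_])
import Data.Integer.Properties as ℤ
open import Data.Nat.Base as ℕ using (ℕ; zero; suc; s≤s; z≤n)
open import Data.Nat.Divisibility using (_∣_; divides)
open import Data.Nat.Induction using (<-rec)
open import Data.Nat.Primality using (Prime; prime?; euclidsLemma)
import Data.Nat.Properties as ℕ
open import Data.Nat.Solver using (module +-*-Solver)
open import Data.Rational.Base as ℚ using (ℚ; 0ℚ; 1ℚ; ↥_; ↧_; ↧ₙ_)
import Data.Rational.Properties as ℚ
import Data.Rational.Solver as ℚ
open import Data.Rational.Unnormalised.Base as ℚᵘ using (*≡*)
import Data.Rational.Unnormalised.Properties as ℚᵘ
open import Data.Sum.Base using (inj₁; inj₂)
open import Relation.Binary.PropositionalEquality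
open import Relation.Nullary.Decidable using (yes; no; from-yes)
open import Relation.Nullary.Negation using (contradiction)

fib : ℕ → ℕ
fib zero          = 0
fib (suc zero)    = 1
fib (suc (suc n)) = fib (suc n) ℕ.+ fib n

luc : ℕ → ℕ
luc zero          = 2
luc (suc zero)    = 1
luc (suc (suc n)) = luc (suc n) ℕ.+ luc n

-- -[1+ m ] is -n with n = suc m, so the sign (-1)ⁿ⁻¹ of F₋ₙ is (-1)ᵐ.
F : ℤ → ℤ
F (+ n)    = + fib n
F -[1+ m ] = (ℤ.- + 1) ℤ.^ m ℤ.* + fib (suc m)

L : ℤ → ℤ
L (+ n)    = + luc n
L -[1+ m ] = (ℤ.- + 1) ℤ.^ suc m ℤ.* + luc (suc m)

-- The field ℚ(√5), inside which both sides of the identity lie: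
-- a +√5· b is the number a + b√5.

infix 5 _+√5·_

record ℚ[√5] : Set where
  constructor _+√5·_
  field
    rat irr : ℚ

open ℚ[√5] public

5ℚ : ℚ
5ℚ = + 5 ℚ./ 1

fromℚ : ℚ → ℚ[√5]
fromℚ a = a +√5· 0ℚ

fromℤ : ℤ → ℚ[√5]
fromℤ i = fromℚ (i ℚ./ 1)

fromℕ : ℕ → ℚ[√5]
fromℕ n = fromℤ (+ n)

0# 1# √5 : ℚ[√5]
0# = fromℕ 0
1# = fromℕ 1
√5 = 0ℚ +√5· 1ℚ

infix  9 _⁻¹
infixr 8 _^_ _^ℤ_
infix  8 -_
infixl 7 _*_ _/_
infixl 6 _+_ _-_

_+_ : ℚ[√5] → ℚ[√5] → ℚ[√5]
(a +√5· b) + (c +√5· d) = (a ℚ.+ c) +√5· (b ℚ.+ d)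

-_ : ℚ[√5] → ℚ[√5]
- (a +√5· b) = (ℚ.- a) +√5· (ℚ.- b)

_-_ : ℚ[√5] → ℚ[√5] → ℚ[√5]
x - y = x + (- y)

_*_ : ℚ[√5] → ℚ[√5] → ℚ[√5]
(a +√5· b) * (c +√5· d) =
  (a ℚ.* c ℚ.+ 5ℚ ℚ.* (b ℚ.* d)) +√5· (a ℚ.* d ℚ.+ b ℚ.* c)

√5*√5≡5 : √5 * √5 ≡ fromℕ 5
√5*√5≡5 = refl

norm : ℚ[√5] → ℚ
norm (a +√5· b) = a ℚ.* a ℚ.- 5ℚ ℚ.* (b ℚ.* b)

recip : ℚ → ℚ
recip q with q ℚ.≟ 0ℚ
... | yes _   = 0ℚ
... | no  q≢0 = ℚ.1/_ q {{ℚ.≢-nonZero q≢0}}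

-- Total inverse: 1/(a + b√5) = (a - b√5)/(a² - 5b²), with the value 0 at 0.
-- See *-inverseʳ below: it is the inverse of every nonzero element.
_⁻¹ : ℚ[√5] → ℚ[√5]
x@(a +√5· b) ⁻¹ = (a ℚ.* recip (norm x)) +√5· (ℚ.- b ℚ.* recip (norm x))

_/_ : ℚ[√5] → ℚ[√5] → ℚ[√5]
x / y = x * y ⁻¹

_^_ : ℚ[√5] → ℕ → ℚ[√5]
x ^ zero  = 1#
x ^ suc n = x * x ^ n

_^ℤ_ : ℚ[√5] → ℤ → ℚ[√5]
x ^ℤ (+ n)    = x ^ n
x ^ℤ -[1+ m ] = (x ⁻¹) ^ suc m

∑₁ : ℕ → (ℕ → ℚ[√5]) → ℚ[√5]
∑₁ zero    f = 0#
∑₁ (suc n) f = ∑₁ n f + f (suc n)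

infix 5 ∑₁
syntax ∑₁ n (λ k → t) = ∑[1≤ k ≤ n ] t

private
  prime5 : Prime 5
  prime5 = from-yes (prime? 5)

  5∣² : ∀ m k → m ℕ.* m ≡ 5 ℕ.* k → 5 ∣ m
  5∣² m k eq with euclidsLemma m m prime5 (divides k (trans eq (ℕ.*-comm 5 k)))
  ... | inj₁ d = d
  ... | inj₂ d = d

  step : ∀ q n → (q ℕ.* 5) ℕ.* (q ℕ.* 5) ≡ 5 ℕ.* (n ℕ.* n) → n ℕ.* n ≡ 5 ℕ.* (q ℕ.* q)
  step q n eq = sym (ℕ.*-cancelˡ-≡ _ _ 5 (trans (lem q) eq))
    where
    open +-*-Solver
    lem : ∀ q → 5 ℕ.* (5 ℕ.* (q ℕ.* q)) ≡ (q ℕ.* 5) ℕ.* (q ℕ.* 5)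
    lem = solve 1 (λ q → con 5 :* (con 5 :* (q :* q)) := (q :* con 5) :* (q :* con 5)) refl

  descent : ∀ n m → m ℕ.* m ≡ 5 ℕ.* (n ℕ.* n) → n ≡ 0
  descent = <-rec _ go
    where
    go : ∀ n → (∀ {r} → r ℕ.< n → ∀ q → q ℕ.* q ≡ 5 ℕ.* (r ℕ.* r) → r ≡ 0) →
         ∀ m → m ℕ.* m ≡ 5 ℕ.* (n ℕ.* n) → n ≡ 0
    go n rec m eq with 5∣² m (n ℕ.* n) eq
    ... | divides q refl with 5∣² n (q ℕ.* q) (step q n eq)
    ...   | divides zero    refl = refl
    ...   | divides (suc r) refl =
      contradiction (rec (ℕ.m<m*n (suc r) 5 (s≤s (s≤s z≤n))) q (step (suc r) q (step q n eq))) λ ()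

  a²≡5b²⇒b≡0 : ∀ a b → a ℚ.* a ≡ 5ℚ ℚ.* (b ℚ.* b) → b ≡ 0ℚ
  a²≡5b²⇒b≡0 a@(ℚ.mkℚ i k _) b@(ℚ.mkℚ j l _) eq
    with ℚᵘ.≃-trans (ℚᵘ.≃-sym (ℚ.toℚᵘ-homo-* a a))
         (ℚᵘ.≃-trans (ℚ.toℚᵘ-cong eq)
         (ℚᵘ.≃-trans (ℚ.toℚᵘ-homo-* 5ℚ (b ℚ.* b))
           (ℚᵘ.*-congˡ {ℚ.toℚᵘ 5ℚ} (ℚ.toℚᵘ-homo-* b b))))
  ... | *≡* cross = ℚ.↥p≡0⇒p≡0 b (ℤ.∣i∣≡0⇒i≡0 ∣j∣≡0)
    where
    open +-*-Solver
    I = ℤ.∣ i ∣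
    H = ℤ.∣ j ∣
    K = suc k
    M = suc l

    abs : (I ℕ.* I) ℕ.* (1 ℕ.* (M ℕ.* M)) ≡ (5 ℕ.* (H ℕ.* H)) ℕ.* (K ℕ.* K)
    abs = trans (sym (trans (ℤ.abs-* (i ℤ.* i) _) (cong (ℕ._* _) (ℤ.abs-* i i))))
         (trans (cong ℤ.∣_∣ cross)
         (trans (ℤ.abs-* (+ 5 ℤ.* (j ℤ.* j)) _)
           (cong (ℕ._* _) (trans (ℤ.abs-* (+ 5) (j ℤ.* j)) (cong (5 ℕ.*_) (ℤ.abs-* j j))))))

    squares : (I ℕ.* M) ℕ.* (I ℕ.* M) ≡ 5 ℕ.* ((H ℕ.* K) ℕ.* (H ℕ.* K))
    squares = trans
      (solve 2 (λ x y → (x :* y) :* (x :* y) := (x :* x) :* (con 1 :* (y :* y))) refl I M)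
      (trans abs
      (solve 2 (λ x y → (con 5 :* (x :* x)) :* (y :* y) := con 5 :* ((x :* y) :* (x :* y))) refl H K))

    ∣j∣≡0 : H ≡ 0
    ∣j∣≡0 = ℕ.m*n≡0⇒m≡0 H K (descent (H ℕ.* K) (I ℕ.* M) squares)

  recip-inverse : ∀ q → q ≢ 0ℚ → q ℚ.* recip q ≡ 1ℚ
  recip-inverse q q≢0 with q ℚ.≟ 0ℚ
  ... | yes q≡0 = contradiction q≡0 q≢0
  ... | no  ≢0  = ℚ.*-inverseʳ q {{ℚ.≢-nonZero ≢0}}

norm≡0⇒≡0 : ∀ x → norm x ≡ 0ℚ → x ≡ 0#
norm≡0⇒≡0 (a +√5· b) eq = cong₂ _+√5·_ a≡0 b≡0
  where
  a²≡5b² : a ℚ.* a ≡ 5ℚ ℚ.* (b ℚ.* b)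
  a²≡5b² = x∙y⁻¹≈ε⇒x≈y ℚ.+-0-group _ _ eq

  b≡0 : b ≡ 0ℚ
  b≡0 = a²≡5b²⇒b≡0 a b a²≡5b²

  a²≡0 : a ℚ.* a ≡ 0ℚ
  a²≡0 = trans a²≡5b² (cong (λ c → 5ℚ ℚ.* (c ℚ.* c)) b≡0)

  a≡0 : a ≡ 0ℚ
  a≡0 = a²≡5b²⇒b≡0 0ℚ a (sym (cong (5ℚ ℚ.*_) a²≡0))

*-inverseʳ : ∀ x → x ≢ 0# → x * x ⁻¹ ≡ 1#
*-inverseʳ x@(a +√5· b) x≢0 = cong₂ _+√5·_
  (trans (solve 3 (λ a b r → a :* (a :* r) :+ con 5ℚ :* (b :* (:- b :* r))
                          := (a :* a :- con 5ℚ :* (b :* b)) :* r) refl a b r)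
         (recip-inverse (norm x) λ eq → x≢0 (norm≡0⇒≡0 x eq)))
  (solve 3 (λ a b r → a :* (:- b :* r) :+ b :* (a :* r) := con 0ℚ) refl a b r)
  where
  open ℚ.+-*-Solver
  r = recip (norm x)

{-# OPTIONS --safe #-}

-- Since k/(n+k) C(n+k,n-k) = ½ C(n+k-1,2k-1), the sum is ½ x U₂ₙ₋₁(x/2), where Uₘ is the
-- Chebyshev polynomial of the second kind and x = 2L₂ₚ / (√5 F₂ₚ).  Now x = t + 1/t for
-- t = Lₚ / (√5 Fₚ), because Lₚ² + 5Fₚ² = 2L₂ₚ and FₚLₚ = F₂ₚ, so U₂ₙ₋₁(x/2) is
-- (t²ⁿ - t⁻²ⁿ)/(t - 1/t), and Lₚ² - 5Fₚ² = 4(-1)ᵖ evaluates the denominator.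
module Submission where

open import Defs
open import Algebra.Bundles using (CommutativeRing)
import Algebra.Solver.Ring.AlmostCommutativeRing as ACR
import Algebra.Solver.Ring.Simple as RingSolver
open import Data.Integer.Base as ℤ using (ℤ; +_; -[1+_]; 0ℤ)
import Data.Integer.Properties as ℤ
open import Data.Nat.Base as ℕ using (ℕ; zero; suc; _∸_; _≤_; z≤n; s≤s)
open import Data.Nat.Combinatorics using (_C_; nCk≡nC[n∸k]; nCk+nC[k+1]≡[n+1]C[k+1])
open import Data.Nat.Combinatorics.Specification using (k>n⇒nCk≡0)
import Data.Nat.Properties as ℕ
import Data.Nat.Solver as ℕ
open import Data.Product.Base using (_,_)
open import Data.Rational.Base as ℚ using (0ℚ; 1ℚ; ½)
import Data.Rational.Properties as ℚ
import Data.Rational.Solver as ℚ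
open import Data.Rational.Unnormalised.Base as ℚᵘ using (mkℚᵘ; *≡*)
import Data.Rational.Unnormalised.Properties as ℚᵘ
open import Relation.Binary.Definitions using (DecidableEquality)
open import Relation.Binary.PropositionalEquality
open import Algebra.Structures {A = ℚ[√5]} _≡_ using (IsCommutativeRing)
open import Relation.Nullary.Decidable using (map′; _×-dec_)
open import Relation.Nullary.Negation using (contradiction)

open ≡-Reasoning

-- The field ℚ(√5) as a commutative ring with decidable equality.

infix 4 _≟_

_≟_ : DecidableEquality ℚ[√5]
(a +√5· b) ≟ (c +√5· d) =
  map′ (λ (p , q) → cong₂ _+√5·_ p q) (λ { refl → refl , refl }) (a ℚ.≟ c ×-dec b ℚ.≟ d)

+-*-isCommutativeRing : IsCommutativeRing _+_ _*_ -_ 0# 1#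
+-*-isCommutativeRing = record
  { isRing = record
    { +-isAbelianGroup = record
      { isGroup = record
        { isMonoid = record
          { isSemigroup = record
            { isMagma = isMagma _+_
            ; assoc   = λ x y z → cong₂ _+√5·_ (ℚ.+-assoc (rat x) (rat y) (rat z))
                                               (ℚ.+-assoc (irr x) (irr y) (irr z))
            }
          ; identity = (λ x → cong₂ _+√5·_ (ℚ.+-identityˡ (rat x)) (ℚ.+-identityˡ (irr x)))
                     , (λ x → cong₂ _+√5·_ (ℚ.+-identityʳ (rat x)) (ℚ.+-identityʳ (irr x)))
          }
        ; inverse = (λ x → cong₂ _+√5·_ (ℚ.+-inverseˡ (rat x)) (ℚ.+-inverseˡ (irr x)))
                  , (λ x → cong₂ _+√5·_ (ℚ.+-inverseʳ (rat x)) (ℚ.+-inverseʳ (irr x)))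
        ; ⁻¹-cong = cong (λ x → - x)
        }
      ; comm = λ x y → cong₂ _+√5·_ (ℚ.+-comm (rat x) (rat y)) (ℚ.+-comm (irr x) (irr y))
      }
    ; *-cong = cong₂ _*_
    ; *-assoc = λ { (a +√5· b) (c +√5· d) (e +√5· f) → cong₂ _+√5·_
        (solve 6 (λ a b c d e f →
           (a :* c :+ con 5ℚ :* (b :* d)) :* e :+ con 5ℚ :* ((a :* d :+ b :* c) :* f)
           := a :* (c :* e :+ con 5ℚ :* (d :* f)) :+ con 5ℚ :* (b :* (c :* f :+ d :* e)))
           refl a b c d e f)
        (solve 6 (λ a b c d e f →
           (a :* c :+ con 5ℚ :* (b :* d)) :* f :+ (a :* d :+ b :* c) :* e
           := a :* (c :* f :+ d :* e) :+ b :* (c :* e :+ con 5ℚ :* (d :* f)))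
           refl a b c d e f) }
    ; *-identity =
        (λ { (a +√5· b) → cong₂ _+√5·_
          (solve 2 (λ a b → con 1ℚ :* a :+ con 5ℚ :* (con 0ℚ :* b) := a) refl a b)
          (solve 2 (λ a b → con 1ℚ :* b :+ con 0ℚ :* a := b) refl a b) })
      , (λ { (a +√5· b) → cong₂ _+√5·_
          (solve 2 (λ a b → a :* con 1ℚ :+ con 5ℚ :* (b :* con 0ℚ) := a) refl a b)
          (solve 2 (λ a b → a :* con 0ℚ :+ b :* con 1ℚ := b) refl a b) })
    ; distrib =
        (λ { (a +√5· b) (c +√5· d) (e +√5· f) → cong₂ _+√5·_
          (solve 6 (λ a b c d e f → a :* (c :+ e) :+ con 5ℚ :* (b :* (d :+ f))
             := (a :* c :+ con 5ℚ :* (b :* d)) :+ (a :* e :+ con 5ℚ :* (b :* f)))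
             refl a b c d e f)
          (solve 6 (λ a b c d e f → a :* (d :+ f) :+ b :* (c :+ e)
             := (a :* d :+ b :* c) :+ (a :* f :+ b :* e))
             refl a b c d e f) })
      , (λ { (a +√5· b) (c +√5· d) (e +√5· f) → cong₂ _+√5·_
          (solve 6 (λ a b c d e f → (c :+ e) :* a :+ con 5ℚ :* ((d :+ f) :* b)
             := (c :* a :+ con 5ℚ :* (d :* b)) :+ (e :* a :+ con 5ℚ :* (f :* b)))
             refl a b c d e f)
          (solve 6 (λ a b c d e f → (c :+ e) :* b :+ (d :+ f) :* a
             := (c :* b :+ d :* a) :+ (e :* b :+ f :* a))
             refl a b c d e f) })
    }
  ; *-comm = λ { (a +√5· b) (c +√5· d) → cong₂ _+√5·_
      (solve 4 (λ a b c d → a :* c :+ con 5ℚ :* (b :* d) := c :* a :+ con 5ℚ :* (d :* b))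
        refl a b c d)
      (solve 4 (λ a b c d → a :* d :+ b :* c := c :* b :+ d :* a) refl a b c d) }
  }
  where
  open ℚ.+-*-Solver
  open import Relation.Binary.PropositionalEquality.Algebra using (isMagma)

+-*-commutativeRing : CommutativeRing _ _
+-*-commutativeRing = record { isCommutativeRing = +-*-isCommutativeRing }

open CommutativeRing +-*-commutativeRing
  using (*-assoc; *-identityˡ; zeroʳ; +-identityʳ; +-assoc; distribˡ)

-- The coefficients of the solver are taken from ℚ(√5) itself, so constants under `con` are
-- evaluated: facts such as √5 · √5 = 5 and ½ · 2 = 1 come out of normalisation.
module Solver = RingSolver (ACR.fromCommutativeRing +-*-commutativeRing) _≟_

open Solver using (solve; _:=_; _:+_; _:*_; _:-_; con)

-- Cancellation, powers and signs.

*-cancelˡ : ∀ x {y z} → x ≢ 0# → x * y ≡ x * z → y ≡ z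
*-cancelˡ x {y} {z} x≢0 xy≡xz = begin
  y              ≡⟨ inv y ⟩
  x ⁻¹ * (x * y) ≡⟨ cong (x ⁻¹ *_) xy≡xz ⟩
  x ⁻¹ * (x * z) ≡⟨ inv z ⟨
  z              ∎
  where
  inv : ∀ y → y ≡ x ⁻¹ * (x * y)
  inv y = begin
    y              ≡⟨ *-identityˡ y ⟨
    1# * y         ≡⟨ cong (_* y) (*-inverseʳ x x≢0) ⟨
    x * x ⁻¹ * y   ≡⟨ solve 3 (λ x x′ y → x :* x′ :* y := x′ :* (x :* y)) refl x (x ⁻¹) y ⟩
    x ⁻¹ * (x * y) ∎

x*y≢0 : ∀ x y → x ≢ 0# → y ≢ 0# → x * y ≢ 0#
x*y≢0 x y x≢0 y≢0 xy≡0 = y≢0 (*-cancelˡ x x≢0 (trans xy≡0 (sym (zeroʳ x))))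

x^n≢0 : ∀ x n → x ≢ 0# → x ^ n ≢ 0#
x^n≢0 x zero    x≢0 = λ ()
x^n≢0 x (suc n) x≢0 = x*y≢0 x (x ^ n) x≢0 (x^n≢0 x n x≢0)

^-distribˡ-+-* : ∀ x m n → x ^ (m ℕ.+ n) ≡ x ^ m * x ^ n
^-distribˡ-+-* x zero    n = sym (*-identityˡ _)
^-distribˡ-+-* x (suc m) n = trans (cong (x *_) (^-distribˡ-+-* x m n)) (sym (*-assoc x _ _))

^-*-assoc : ∀ x m n → (x ^ m) ^ n ≡ x ^ (m ℕ.* n)
^-*-assoc x m zero    = cong (x ^_) (sym (ℕ.*-zeroʳ m))
^-*-assoc x m (suc n) = begin
  x ^ m * (x ^ m) ^ n    ≡⟨ cong (x ^ m *_) (^-*-assoc x m n) ⟩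
  x ^ m * x ^ (m ℕ.* n)  ≡⟨ ^-distribˡ-+-* x m (m ℕ.* n) ⟨
  x ^ (m ℕ.+ m ℕ.* n)    ≡⟨ cong (x ^_) (ℕ.*-suc m n) ⟨
  x ^ (m ℕ.* suc n)      ∎

^-distribʳ-* : ∀ x y n → (x * y) ^ n ≡ x ^ n * y ^ n
^-distribʳ-* x y zero    = refl
^-distribʳ-* x y (suc n) = trans (cong (x * y *_) (^-distribʳ-* x y n))
  (solve 4 (λ x y u v → x :* y :* (u :* v) := x :* u :* (y :* v)) refl x y (x ^ n) (y ^ n))

-1^n*-1^n≡1 : ∀ n → (- 1#) ^ n * (- 1#) ^ n ≡ 1#
-1^n*-1^n≡1 zero    = refl
-1^n*-1^n≡1 (suc n) = trans
  (solve 1 (λ s → (con (- 1#) :* s) :* (con (- 1#) :* s) := s :* s) refl ((- 1#) ^ n))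
  (-1^n*-1^n≡1 n)

-- Induction on the proof of `k ≤ n` lets the truncated subtraction compute: raising both `n` and
-- `k` leaves the left side unchanged and adds two signs on the right, which cancel.
-1^[n∸k] : ∀ {k n} → k ≤ n → (- 1#) ^ (n ∸ k) ≡ (- 1#) ^ n * (- 1#) ^ k
-1^[n∸k] {n = n} z≤n = solve 1 (λ s → s := s :* con 1#) refl ((- 1#) ^ n)
-1^[n∸k] (s≤s {k} {n} k≤n) = trans (-1^[n∸k] k≤n)
  (solve 2 (λ s t → s :* t := (con (- 1#) :* s) :* (con (- 1#) :* t)) refl ((- 1#) ^ n) ((- 1#) ^ k))

-- The embeddings of ℕ and ℤ in ℚ(√5).

toℚᵘ-/1 : ∀ i → ℚ.toℚᵘ (i ℚ./ 1) ℚᵘ.≃ mkℚᵘ i 0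
toℚᵘ-/1 i = ℚ.toℚᵘ-fromℚᵘ (mkℚᵘ i 0)

-- The normalised fraction `i / 1` does not reduce for a variable `i`. Among unnormalised fractions
-- the denominator is literally 1, and the claim becomes a law of ℤ.
/1-homo-+ : ∀ i j → (i ℤ.+ j) ℚ./ 1 ≡ (i ℚ./ 1) ℚ.+ (j ℚ./ 1)
/1-homo-+ i j = ℚ.toℚᵘ-injective (ℚᵘ.≃-trans (toℚᵘ-/1 (i ℤ.+ j)) (ℚᵘ.≃-trans
  (*≡* (cong (ℤ._* + 1) (cong₂ ℤ._+_ (sym (ℤ.*-identityʳ i)) (sym (ℤ.*-identityʳ j)))))
  (ℚᵘ.≃-trans (ℚᵘ.+-cong (ℚᵘ.≃-sym (toℚᵘ-/1 i)) (ℚᵘ.≃-sym (toℚᵘ-/1 j)))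
    (ℚᵘ.≃-sym (ℚ.toℚᵘ-homo-+ (i ℚ./ 1) (j ℚ./ 1))))))

/1-homo-* : ∀ i j → (i ℤ.* j) ℚ./ 1 ≡ (i ℚ./ 1) ℚ.* (j ℚ./ 1)
/1-homo-* i j = ℚ.toℚᵘ-injective (ℚᵘ.≃-trans (toℚᵘ-/1 (i ℤ.* j))
  (ℚᵘ.≃-trans (ℚᵘ.*-cong (ℚᵘ.≃-sym (toℚᵘ-/1 i)) (ℚᵘ.≃-sym (toℚᵘ-/1 j)))
    (ℚᵘ.≃-sym (ℚ.toℚᵘ-homo-* (i ℚ./ 1) (j ℚ./ 1)))))

fromℚ-homo-* : ∀ a b → fromℚ (a ℚ.* b) ≡ fromℚ a * fromℚ b
fromℚ-homo-* a b = cong₂ _+√5·_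
  (ℚS.solve 2 (λ a b → a ℚS.:* b ℚS.:= a ℚS.:* b ℚS.:+ ℚS.con 5ℚ ℚS.:* (ℚS.con 0ℚ ℚS.:* ℚS.con 0ℚ)) refl a b)
  (ℚS.solve 2 (λ a b → ℚS.con 0ℚ ℚS.:= a ℚS.:* ℚS.con 0ℚ ℚS.:+ ℚS.con 0ℚ ℚS.:* b) refl a b)
  where module ℚS = ℚ.+-*-Solver

fromℤ-homo-* : ∀ i j → fromℤ (i ℤ.* j) ≡ fromℤ i * fromℤ j
fromℤ-homo-* i j = trans (cong fromℚ (/1-homo-* i j)) (fromℚ-homo-* (i ℚ./ 1) (j ℚ./ 1))

fromℤ-homo-^ : ∀ i n → fromℤ (i ℤ.^ n) ≡ fromℤ i ^ n
fromℤ-homo-^ i zero    = refl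
fromℤ-homo-^ i (suc n) = trans (fromℤ-homo-* i (i ℤ.^ n)) (cong (fromℤ i *_) (fromℤ-homo-^ i n))

fromℕ-homo-+ : ∀ m n → fromℕ (m ℕ.+ n) ≡ fromℕ m + fromℕ n
fromℕ-homo-+ m n = cong fromℚ (/1-homo-+ (+ m) (+ n))

fromℕ-homo-* : ∀ m n → fromℕ (m ℕ.* n) ≡ fromℕ m * fromℕ n
fromℕ-homo-* m n = trans (cong fromℤ (ℤ.pos-* m n)) (fromℤ-homo-* (+ m) (+ n))

fromℤ≡0⇒≡0 : ∀ i → fromℤ i ≡ 0# → i ≡ 0ℤ
fromℤ≡0⇒≡0 i eq with ℚ.fromℚᵘ-injective {mkℚᵘ i 0} {mkℚᵘ 0ℤ 0} (cong rat eq)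
... | *≡* i*1≡0 = trans (sym (ℤ.*-identityʳ i)) i*1≡0

fromℕ-suc≢0 : ∀ n → fromℕ (suc n) ≢ 0#
fromℕ-suc≢0 n eq = contradiction (fromℤ≡0⇒≡0 (+ suc n) eq) λ ()

-- Finite sums, and absorption for binomial coefficients.

∑₁-cong : ∀ n {f g : ℕ → ℚ[√5]} → (∀ j → j ℕ.< n → f (suc j) ≡ g (suc j)) → ∑₁ n f ≡ ∑₁ n g
∑₁-cong zero    f≡g = refl
∑₁-cong (suc n) f≡g =
  cong₂ _+_ (∑₁-cong n λ j j<n → f≡g j (ℕ.m<n⇒m<1+n j<n)) (f≡g n ℕ.≤-refl)

∑₁-*-distribˡ : ∀ n x f → ∑₁ n (λ k → x * f k) ≡ x * ∑₁ n f
∑₁-*-distribˡ zero    x f = sym (zeroʳ x)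
∑₁-*-distribˡ (suc n) x f = trans (cong (_+ x * f (suc n)) (∑₁-*-distribˡ n x f))
  (sym (distribˡ x (∑₁ n f) (f (suc n))))

∑₁-linear : ∀ n x y f g → ∑₁ n (λ k → x * f k + y * g k) ≡ x * ∑₁ n f + y * ∑₁ n g
∑₁-linear zero    x y f g = solve 2 (λ x y → con 0# := x :* con 0# :+ y :* con 0#) refl x y
∑₁-linear (suc n) x y f g = trans
  (cong (_+ (x * f (suc n) + y * g (suc n))) (∑₁-linear n x y f g))
  (solve 6 (λ x y F G u v → (x :* F :+ y :* G) :+ (x :* u :+ y :* v)
                         := x :* (F :+ u) :+ y :* (G :+ v))
    refl x y (∑₁ n f) (∑₁ n g) (f (suc n)) (g (suc n)))

∑₁-head : ∀ n f → ∑₁ (suc n) f ≡ f 1 + ∑₁ n (λ k → f (suc k))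
∑₁-head zero    f = solve 1 (λ x → con 0# :+ x := x :+ con 0#) refl (f 1)
∑₁-head (suc n) f = trans (cong (_+ f (suc (suc n))) (∑₁-head n f))
  (+-assoc (f 1) (∑₁ n (λ k → f (suc k))) (f (suc (suc n))))

-- Induction on `n` by Pascal's rule. Expanding C(n+2, k+2) as `A + B` and setting one `A` aside
-- leaves two products to which the induction hypothesis applies; their right sides recombine, again
-- by Pascal, into `suc n` times `A`.
[1+k]*[1+n]C[1+k]≡[1+n]*nCk : ∀ n k → suc k ℕ.* (suc n C suc k) ≡ suc n ℕ.* (n C k)
[1+k]*[1+n]C[1+k]≡[1+n]*nCk zero    zero    = refl
[1+k]*[1+n]C[1+k]≡[1+n]*nCk zero    (suc k) =
  trans (cong (suc (suc k) ℕ.*_) (k>n⇒nCk≡0 {1} {suc (suc k)} (s≤s (s≤s z≤n))))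
        (ℕ.*-zeroʳ (suc (suc k)))
[1+k]*[1+n]C[1+k]≡[1+n]*nCk (suc n) zero    = begin
  1 ℕ.* (suc (suc n) C 1)            ≡⟨ cong (1 ℕ.*_) (sym (nCk+nC[k+1]≡[n+1]C[k+1] (suc n) 0)) ⟩
  1 ℕ.* (1 ℕ.+ (suc n C 1))          ≡⟨ ℕ.*-distribˡ-+ 1 1 (suc n C 1) ⟩
  1 ℕ.+ 1 ℕ.* (suc n C 1)            ≡⟨ cong (1 ℕ.+_) ([1+k]*[1+n]C[1+k]≡[1+n]*nCk n 0) ⟩
  suc (suc n) ℕ.* 1                  ∎
[1+k]*[1+n]C[1+k]≡[1+n]*nCk (suc n) (suc k) = begin
  suc (suc k) ℕ.* (suc (suc n) C suc (suc k))
    ≡⟨ cong (suc (suc k) ℕ.*_) (sym (nCk+nC[k+1]≡[n+1]C[k+1] (suc n) (suc k))) ⟩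
  suc (suc k) ℕ.* (A ℕ.+ B)
    ≡⟨ ℕS.solve 3 (λ k A B → (ℕS.con 2 ℕS.:+ k) ℕS.:* (A ℕS.:+ B)
         ℕS.:= A ℕS.:+ ((ℕS.con 1 ℕS.:+ k) ℕS.:* A ℕS.:+ (ℕS.con 2 ℕS.:+ k) ℕS.:* B)) refl k A B ⟩
  A ℕ.+ (suc k ℕ.* A ℕ.+ suc (suc k) ℕ.* B)
    ≡⟨ cong (A ℕ.+_) (cong₂ ℕ._+_ ([1+k]*[1+n]C[1+k]≡[1+n]*nCk n k)
                                  ([1+k]*[1+n]C[1+k]≡[1+n]*nCk n (suc k))) ⟩
  A ℕ.+ (suc n ℕ.* (n C k) ℕ.+ suc n ℕ.* (n C suc k))
    ≡⟨ cong (A ℕ.+_) (ℕ.*-distribˡ-+ (suc n) (n C k) (n C suc k)) ⟨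
  A ℕ.+ suc n ℕ.* ((n C k) ℕ.+ (n C suc k))
    ≡⟨ cong (λ c → A ℕ.+ suc n ℕ.* c) (nCk+nC[k+1]≡[n+1]C[k+1] n k) ⟩
  suc (suc n) ℕ.* A ∎
  where
  module ℕS = ℕ.+-*-Solver
  A = suc n C suc k
  B = suc n C suc (suc k)

-- Chebyshev polynomials: recurrences and closed forms.

-- With y = x², odd n is x U₂ₙ₋₁(x/2) and even n is U₂ₙ(x/2).  Writing the coefficients as
-- C(n+j,2j+1) and C(n+j,2j), with sign (-1)ⁿ(-1)ʲ in place of (-1)ⁿ⁻ʲ, makes them satisfy
-- Pascal's rule with no truncated subtraction and vanish on their own beyond the top degree.
module Chebyshev (y : ℚ[√5]) where

  oddTerm evenTerm : ℕ → ℕ → ℚ[√5]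
  oddTerm  n j = (- 1#) ^ n * (- 1#) ^ suc j * fromℕ ((n ℕ.+ j) C suc (2 ℕ.* j)) * y ^ suc j
  evenTerm n j = (- 1#) ^ n * (- 1#) ^ j * fromℕ ((n ℕ.+ j) C (2 ℕ.* j)) * y ^ j

  -- `∑₁` starts at 1 but j starts at 0, hence `pred`. In `even n` the index j runs from 0 to n, one
  -- term more than in `odd n`.
  odd even : ℕ → ℚ[√5]
  odd  n = ∑[1≤ k ≤ n ] oddTerm n (ℕ.pred k)
  even n = ∑[1≤ k ≤ suc n ] evenTerm n (ℕ.pred k)

  -- Pascal's rule for C(n+1+j, 2j+1). Summed over j it is x times the recurrence U₂ₙ₊₁ = x U₂ₙ -
  -- U₂ₙ₋₁.
  oddTerm-suc : ∀ n j → oddTerm (suc n) j ≡ y * evenTerm n j + - 1# * oddTerm n j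
  oddTerm-suc n j = trans
    (cong (λ c → (- 1#) ^ suc n * (- 1#) ^ suc j * c * y ^ suc j)
      (trans (cong fromℕ (sym (nCk+nC[k+1]≡[n+1]C[k+1] (n ℕ.+ j) (2 ℕ.* j))))
             (fromℕ-homo-+ ((n ℕ.+ j) C (2 ℕ.* j)) ((n ℕ.+ j) C suc (2 ℕ.* j)))))
    (solve 6 (λ y s t A B z →
         (con (- 1#) :* s) :* (con (- 1#) :* t) :* (A :+ B) :* (y :* z)
      := y :* (s :* t :* A :* z) :+ con (- 1#) :* (s :* (con (- 1#) :* t) :* B :* (y :* z)))
      refl y ((- 1#) ^ n) ((- 1#) ^ j) _ _ (y ^ j))

  -- Pascal's rule for C(n+j+2, 2j+2), the termwise form of U₂ₙ₊₂ = x U₂ₙ₊₁ - U₂ₙ. A power of `y` in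
  -- `even` meets the same power in `odd`, whose index is lower by one. The factor `1#` gives the
  -- shape that `∑₁-linear` expects.
  evenTerm-suc : ∀ n j → evenTerm (suc n) (suc j) ≡ 1# * oddTerm (suc n) j + - 1# * evenTerm n (suc j)
  evenTerm-suc n j = begin
    evenTerm (suc n) (suc j)
      ≡⟨ cong (λ c → (- 1#) ^ suc n * (- 1#) ^ suc j * fromℕ c * y ^ suc j)
           (cong₂ _C_ (cong suc (ℕ.+-suc n j)) (ℕ.*-suc 2 j)) ⟩
    (- 1#) ^ suc n * (- 1#) ^ suc j * fromℕ (suc (suc (n ℕ.+ j)) C suc (suc (2 ℕ.* j))) * y ^ suc j
      ≡⟨ cong (λ c → (- 1#) ^ suc n * (- 1#) ^ suc j * c * y ^ suc j)
           (trans (cong fromℕ (sym (nCk+nC[k+1]≡[n+1]C[k+1] (suc (n ℕ.+ j)) (suc (2 ℕ.* j)))))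
             (fromℕ-homo-+ (suc (n ℕ.+ j) C suc (2 ℕ.* j)) (suc (n ℕ.+ j) C suc (suc (2 ℕ.* j))))) ⟩
    (- 1#) ^ suc n * (- 1#) ^ suc j * (A + B) * y ^ suc j
      ≡⟨ solve 5 (λ s t A B z → (con (- 1#) :* s) :* t :* (A :+ B) :* z
           := con 1# :* ((con (- 1#) :* s) :* t :* A :* z) :+ con (- 1#) :* (s :* t :* B :* z))
           refl ((- 1#) ^ n) ((- 1#) ^ suc j) A B (y ^ suc j) ⟩
    1# * oddTerm (suc n) j + - 1# * ((- 1#) ^ n * (- 1#) ^ suc j * B * y ^ suc j)
      ≡⟨ cong (λ c → 1# * oddTerm (suc n) j + - 1# * ((- 1#) ^ n * (- 1#) ^ suc j * fromℕ c * y ^ suc j))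
           (cong₂ _C_ (ℕ.+-suc n j) (ℕ.*-suc 2 j)) ⟨
    1# * oddTerm (suc n) j + - 1# * evenTerm n (suc j) ∎
    where
    A = fromℕ (suc (n ℕ.+ j) C suc (2 ℕ.* j))
    B = fromℕ (suc (n ℕ.+ j) C suc (suc (2 ℕ.* j)))

  evenTerm-zero : ∀ n → evenTerm (suc n) 0 ≡ - 1# * evenTerm n 0
  evenTerm-zero n = solve 1 (λ s → con (- 1#) :* s :* con 1# :* con 1# :* con 1#
                               := con (- 1#) :* (s :* con 1# :* con 1# :* con 1#)) refl ((- 1#) ^ n)

  -- The lower index exceeds the upper one by 1. The form `k + 0` is what `2 * k` unfolds to, so
  -- that `k = n` and `k = suc n`, with `m = n`, match the two top terms definitionally.
  [m+k]C[1+m+k]≡0 : ∀ m k → fromℕ ((m ℕ.+ k) C suc (m ℕ.+ (k ℕ.+ 0))) ≡ 0#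
  [m+k]C[1+m+k]≡0 m k = cong fromℕ
    (k>n⇒nCk≡0 {m ℕ.+ k} (ℕ.≤-reflexive (cong (λ k → suc (m ℕ.+ k)) (sym (ℕ.+-identityʳ k)))))

  oddTerm-top : ∀ n → oddTerm n n ≡ 0#
  oddTerm-top n = trans
    (cong (λ c → (- 1#) ^ n * (- 1#) ^ suc n * c * y ^ suc n) ([m+k]C[1+m+k]≡0 n n))
    (solve 2 (λ x z → x :* con 0# :* z := con 0#) refl ((- 1#) ^ n * (- 1#) ^ suc n) (y ^ suc n))

  evenTerm-top : ∀ n → evenTerm n (suc n) ≡ 0#
  evenTerm-top n = trans
    (cong (λ c → (- 1#) ^ n * (- 1#) ^ suc n * c * y ^ suc n) ([m+k]C[1+m+k]≡0 n (suc n)))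
    (solve 2 (λ x z → x :* con 0# :* z := con 0#) refl ((- 1#) ^ n * (- 1#) ^ suc n) (y ^ suc n))

  odd-suc : ∀ n → odd (suc n) ≡ y * even n - odd n
  odd-suc n = begin
    odd (suc n)
      ≡⟨ ∑₁-cong (suc n) (λ j _ → oddTerm-suc n j) ⟩
    (∑[1≤ k ≤ suc n ] (y * evenTerm n (ℕ.pred k) + - 1# * oddTerm n (ℕ.pred k)))
      ≡⟨ ∑₁-linear (suc n) y (- 1#) _ _ ⟩
    y * even n + - 1# * (odd n + oddTerm n n)
      -- A sum of length `suc n` overshoots `odd n` by one term, whose coefficient is C(2n, 2n+1) =
      -- 0.
      ≡⟨ cong (λ t → y * even n + - 1# * (odd n + t)) (oddTerm-top n) ⟩
    y * even n + - 1# * (odd n + 0#)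
      ≡⟨ solve 2 (λ u v → u :+ con (- 1#) :* (v :+ con 0#) := u :- v) refl (y * even n) (odd n) ⟩
    y * even n - odd n ∎

  even-suc : ∀ n → even (suc n) ≡ odd (suc n) - even n
  even-suc n = begin
    even (suc n)
      -- The constant term has no partner in `odd (suc n)`, so it is split off and only changes
      -- sign. Below it rejoins `tail`, and together they make up `even n` plus a vanishing top
      -- term.
      ≡⟨ ∑₁-head (suc n) _ ⟩
    evenTerm (suc n) 0 + ∑₁ (suc n) (evenTerm (suc n))
      ≡⟨ cong₂ _+_ (evenTerm-zero n) (trans (∑₁-cong (suc n) (λ j _ → evenTerm-suc n j))
                                            (∑₁-linear (suc n) 1# (- 1#) _ (evenTerm n))) ⟩
    - 1# * evenTerm n 0 + (1# * odd (suc n) + - 1# * tail)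
      ≡⟨ solve 3 (λ e o t → con (- 1#) :* e :+ (con 1# :* o :+ con (- 1#) :* t) := o :- (e :+ t))
           refl (evenTerm n 0) (odd (suc n)) tail ⟩
    odd (suc n) - (evenTerm n 0 + tail)
      ≡⟨ cong (λ s → odd (suc n) - s) (∑₁-head (suc n) (λ k → evenTerm n (ℕ.pred k))) ⟨
    odd (suc n) - (even n + evenTerm n (suc n))
      ≡⟨ cong (λ t → odd (suc n) - (even n + t)) (evenTerm-top n) ⟩
    odd (suc n) - (even n + 0#)
      ≡⟨ cong (λ s → odd (suc n) - s) (+-identityʳ (even n)) ⟩
    odd (suc n) - even n ∎
    where
    tail = ∑₁ (suc n) (evenTerm n)

  -- d = ab clears the denominators: t = a / √d and 1/t = b / √d.
  module ClosedForm (a b d : ℚ[√5]) (d≡ab : d ≡ a * b) (dy≡[a+b]² : d * y ≡ (a + b) * (a + b)) where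

    mutual
      -- The factors `d ^ n` and `a - b` stay on the left, so that each step is a ring identity once
      -- `d` and `d * y` are replaced. The recursion is mutual because each recurrence mixes the two
      -- parities.
      odd-closed : ∀ n → d ^ n * odd n * (a - b) ≡ (a + b) * ((a * a) ^ n - (b * b) ^ n)
      odd-closed zero = solve 2 (λ a b → con 1# :* con 0# :* (a :- b) := (a :+ b) :* (con 1# :- con 1#)) refl a b
      odd-closed (suc n) = begin
        d ^ suc n * odd (suc n) * (a - b)
          ≡⟨ cong (λ o → d ^ suc n * o * (a - b)) (odd-suc n) ⟩
        d * d ^ n * (y * even n - odd n) * (a - b)
          ≡⟨ solve 6 (λ d z y e o c → d :* z :* (y :* e :- o) :* c
               := (d :* y) :* (z :* e :* c) :- d :* (z :* o :* c)) refl d (d ^ n) y (even n) (odd n) (a - b) ⟩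
        (d * y) * (d ^ n * even n * (a - b)) - d * (d ^ n * odd n * (a - b))
          ≡⟨ cong₂ _-_ (cong₂ _*_ dy≡[a+b]² (even-closed n)) (cong₂ _*_ d≡ab (odd-closed n)) ⟩
        (a + b) * (a + b) * (a * A - b * B) - a * b * ((a + b) * (A - B))
          ≡⟨ solve 4 (λ a b A B →
               (a :+ b) :* (a :+ b) :* (a :* A :- b :* B) :- a :* b :* ((a :+ b) :* (A :- B))
               := (a :+ b) :* (a :* a :* A :- b :* b :* B)) refl a b A B ⟩
        (a + b) * ((a * a) ^ suc n - (b * b) ^ suc n) ∎
        where
        A = (a * a) ^ n
        B = (b * b) ^ n

      even-closed : ∀ n → d ^ n * even n * (a - b) ≡ a * (a * a) ^ n - b * (b * b) ^ n
      even-closed zero = solve 2 (λ a b →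
        con 1# :* (con 0# :+ con 1# :* con 1# :* con 1# :* con 1#) :* (a :- b)
        := a :* con 1# :- b :* con 1#) refl a b
      even-closed (suc n) = begin
        d ^ suc n * even (suc n) * (a - b)
          ≡⟨ cong (λ e → d ^ suc n * e * (a - b)) (even-suc n) ⟩
        d * d ^ n * (odd (suc n) - even n) * (a - b)
          ≡⟨ solve 5 (λ d z o e c → d :* z :* (o :- e) :* c := d :* z :* o :* c :- d :* (z :* e :* c))
               refl d (d ^ n) (odd (suc n)) (even n) (a - b) ⟩
        d ^ suc n * odd (suc n) * (a - b) - d * (d ^ n * even n * (a - b))
          ≡⟨ cong₂ _-_ (odd-closed (suc n)) (cong₂ _*_ d≡ab (even-closed n)) ⟩
        (a + b) * (a * a * A - b * b * B) - a * b * (a * A - b * B)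
          ≡⟨ solve 4 (λ a b A B →
               (a :+ b) :* (a :* a :* A :- b :* b :* B) :- a :* b :* (a :* A :- b :* B)
               := a :* (a :* a :* A) :- b :* (b :* b :* B)) refl a b A B ⟩
        a * (a * a) ^ suc n - b * (b * b) ^ suc n ∎
        where
        A = (a * a) ^ n
        B = (b * b) ^ n

-- With k = j + 1, symmetry turns C(n+k, n-k) into C(n+k, 2k), and absorption, 2k C(n+k, 2k) = (n+k)
-- C(n+k-1, 2k-1), then removes the denominator n+k.
k/[n+k]*[n+k]C[n∸k] : ∀ n j → suc j ≤ n →
  fromℕ (suc j) / fromℕ (n ℕ.+ suc j) * fromℕ ((n ℕ.+ suc j) C (n ∸ suc j))
  ≡ fromℚ ½ * fromℕ ((n ℕ.+ j) C suc (2 ℕ.* j))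
k/[n+k]*[n+k]C[n∸k] n j k≤n = begin
  K / fromℕ (n ℕ.+ suc j) * fromℕ ((n ℕ.+ suc j) C (n ∸ suc j))
    ≡⟨ cong₂ (λ m c → K / fromℕ m * fromℕ c) (ℕ.+-suc n j) C≡ ⟩
  K / N * B
    -- The product ½ · 2 is inserted so that `B` is multiplied by 2k, its lower index, as absorption
    -- requires.
    ≡⟨ solve 3 (λ K N B → K :* N :* B := con (fromℚ ½) :* N :* (con (fromℕ 2) :* K :* B)) refl K (N ⁻¹) B ⟩
  fromℚ ½ * N ⁻¹ * (fromℕ 2 * K * B)
    ≡⟨ cong (fromℚ ½ * N ⁻¹ *_) absorb ⟩
  fromℚ ½ * N ⁻¹ * (N * A)
    ≡⟨ solve 3 (λ N N′ A → con (fromℚ ½) :* N′ :* (N :* A) := con (fromℚ ½) :* (N :* N′ :* A)) refl N (N ⁻¹) A ⟩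
  fromℚ ½ * (N * N ⁻¹ * A)
    ≡⟨ cong (λ i → fromℚ ½ * (i * A)) (*-inverseʳ N (fromℕ-suc≢0 (n ℕ.+ j))) ⟩
  fromℚ ½ * (1# * A)
    ≡⟨ cong (fromℚ ½ *_) (*-identityˡ A) ⟩
  fromℚ ½ * A ∎
  where
  K = fromℕ (suc j)
  N = fromℕ (suc (n ℕ.+ j))
  A = fromℕ ((n ℕ.+ j) C suc (2 ℕ.* j))
  B = fromℕ (suc (n ℕ.+ j) C suc (suc (2 ℕ.* j)))

  C≡ : (n ℕ.+ suc j) C (n ∸ suc j) ≡ suc (n ℕ.+ j) C suc (suc (2 ℕ.* j))
  C≡ = begin
    (n ℕ.+ suc j) C (n ∸ suc j)
      ≡⟨ cong ((n ℕ.+ suc j) C_) (begin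
           n ∸ suc j
             ≡⟨ cong (n ∸_) (ℕ.+-identityʳ (suc j)) ⟨
           n ∸ (suc j ℕ.+ 0)
             ≡⟨ ℕ.[m+n]∸[m+o]≡n∸o (suc j) n (suc j ℕ.+ 0) ⟨
           (suc j ℕ.+ n) ∸ (2 ℕ.* suc j)
             ≡⟨ cong (_∸ (2 ℕ.* suc j)) (ℕ.+-comm (suc j) n) ⟩
           (n ℕ.+ suc j) ∸ (2 ℕ.* suc j) ∎) ⟩
    (n ℕ.+ suc j) C ((n ℕ.+ suc j) ∸ (2 ℕ.* suc j))
      -- Symmetry of the binomial needs 2k ≤ n + k, which is where k ≤ n enters.
      ≡⟨ nCk≡nC[n∸k] (ℕ.+-mono-≤ k≤n (ℕ.≤-reflexive (ℕ.+-identityʳ (suc j)))) ⟨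
    (n ℕ.+ suc j) C (2 ℕ.* suc j)
      ≡⟨ cong₂ _C_ (ℕ.+-suc n j) (ℕ.*-suc 2 j) ⟩
    suc (n ℕ.+ j) C suc (suc (2 ℕ.* j)) ∎

  absorb : fromℕ 2 * K * B ≡ N * A
  absorb = begin
    fromℕ 2 * K * B
      ≡⟨ cong (_* B) (fromℕ-homo-* 2 (suc j)) ⟨
    fromℕ (2 ℕ.* suc j) * B
      ≡⟨ cong (λ i → fromℕ i * B) (ℕ.*-suc 2 j) ⟩
    fromℕ (suc (suc (2 ℕ.* j))) * B
      ≡⟨ fromℕ-homo-* (suc (suc (2 ℕ.* j))) (suc (n ℕ.+ j) C suc (suc (2 ℕ.* j))) ⟨
    fromℕ (suc (suc (2 ℕ.* j)) ℕ.* (suc (n ℕ.+ j) C suc (suc (2 ℕ.* j))))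
      ≡⟨ cong fromℕ ([1+k]*[1+n]C[1+k]≡[1+n]*nCk (n ℕ.+ j) (suc (2 ℕ.* j))) ⟩
    fromℕ (suc (n ℕ.+ j) ℕ.* ((n ℕ.+ j) C suc (2 ℕ.* j)))
      ≡⟨ fromℕ-homo-* (suc (n ℕ.+ j)) ((n ℕ.+ j) C suc (2 ℕ.* j)) ⟩
    N * A ∎

-- Fibonacci and Lucas identities at natural indices.

f l : ℕ → ℚ[√5]
f n = fromℕ (fib n)
l n = fromℕ (luc n)

f-rec : ∀ n → f (suc (suc n)) ≡ f (suc n) + f n
f-rec n = fromℕ-homo-+ (fib (suc n)) (fib n)

l-rec : ∀ n → l (suc (suc n)) ≡ l (suc n) + l n
l-rec n = fromℕ-homo-+ (luc (suc n)) (luc n)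

-- Both sides obey the Fibonacci recurrence, so two initial values decide. Together with `2l-suc`
-- this says that Lₙ + Fₙ√5 is multiplied by (1 + √5)/2 when n grows by 1.
2f-suc : ∀ n → fromℕ 2 * f (suc n) ≡ f n + l n
2f-suc zero          = refl
2f-suc (suc zero)    = refl
2f-suc (suc (suc n)) = begin
  fromℕ 2 * f (suc (suc (suc n)))                     ≡⟨ cong (fromℕ 2 *_) (f-rec (suc n)) ⟩
  fromℕ 2 * (f (suc (suc n)) + f (suc n))             ≡⟨ distribˡ (fromℕ 2) (f (suc (suc n))) (f (suc n)) ⟩
  fromℕ 2 * f (suc (suc n)) + fromℕ 2 * f (suc n)     ≡⟨ cong₂ _+_ (2f-suc (suc n)) (2f-suc n) ⟩
  (f (suc n) + l (suc n)) + (f n + l n)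
    ≡⟨ solve 4 (λ a b c d → (a :+ b) :+ (c :+ d) := (a :+ c) :+ (b :+ d)) refl (f (suc n)) (l (suc n)) (f n) (l n) ⟩
  (f (suc n) + f n) + (l (suc n) + l n)               ≡⟨ cong₂ _+_ (f-rec n) (l-rec n) ⟨
  f (suc (suc n)) + l (suc (suc n))                   ∎

2l-suc : ∀ n → fromℕ 2 * l (suc n) ≡ l n + fromℕ 5 * f n
2l-suc zero          = refl
2l-suc (suc zero)    = refl
2l-suc (suc (suc n)) = begin
  fromℕ 2 * l (suc (suc (suc n)))                     ≡⟨ cong (fromℕ 2 *_) (l-rec (suc n)) ⟩
  fromℕ 2 * (l (suc (suc n)) + l (suc n))             ≡⟨ distribˡ (fromℕ 2) (l (suc (suc n))) (l (suc n)) ⟩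
  fromℕ 2 * l (suc (suc n)) + fromℕ 2 * l (suc n)     ≡⟨ cong₂ _+_ (2l-suc (suc n)) (2l-suc n) ⟩
  (l (suc n) + fromℕ 5 * f (suc n)) + (l n + fromℕ 5 * f n)
    ≡⟨ solve 4 (λ a b c d → (a :+ con (fromℕ 5) :* b) :+ (c :+ con (fromℕ 5) :* d)
                        := (a :+ c) :+ con (fromℕ 5) :* (b :+ d)) refl (l (suc n)) (f (suc n)) (l n) (f n) ⟩
  (l (suc n) + l n) + fromℕ 5 * (f (suc n) + f n)
    ≡⟨ cong₂ (λ u v → u + fromℕ 5 * v) (l-rec n) (f-rec n) ⟨
  l (suc (suc n)) + fromℕ 5 * f (suc (suc n))         ∎

mutual
  -- Induction on `m` with the shift formulas `2f-suc` and `2l-suc`, applied first at `m + n` and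
  -- then backwards at `m`. Each shift mixes F and L, hence the mutual recursion; it also costs a
  -- factor 2, which is cancelled at the end.
  2f-+ : ∀ m n → fromℕ 2 * f (m ℕ.+ n) ≡ f m * l n + l m * f n
  2f-+ zero    n = solve 2 (λ F L → con (fromℕ 2) :* F := con 0# :* L :+ con (fromℕ 2) :* F) refl (f n) (l n)
  2f-+ (suc m) n = *-cancelˡ (fromℕ 2) (λ ()) (begin
    fromℕ 2 * (fromℕ 2 * f (suc m ℕ.+ n))           ≡⟨ cong (fromℕ 2 *_) (2f-suc (m ℕ.+ n)) ⟩
    fromℕ 2 * (f (m ℕ.+ n) + l (m ℕ.+ n))           ≡⟨ distribˡ (fromℕ 2) (f (m ℕ.+ n)) (l (m ℕ.+ n)) ⟩
    fromℕ 2 * f (m ℕ.+ n) + fromℕ 2 * l (m ℕ.+ n)   ≡⟨ cong₂ _+_ (2f-+ m n) (2l-+ m n) ⟩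
    (f m * l n + l m * f n) + (l m * l n + fromℕ 5 * (f m * f n))
      ≡⟨ solve 4 (λ f l F L → (f :* L :+ l :* F) :+ (l :* L :+ con (fromℕ 5) :* (f :* F))
                           := (f :+ l) :* L :+ (l :+ con (fromℕ 5) :* f) :* F) refl (f m) (l m) (f n) (l n) ⟩
    (f m + l m) * l n + (l m + fromℕ 5 * f m) * f n
      ≡⟨ cong₂ (λ u v → u * l n + v * f n) (2f-suc m) (2l-suc m) ⟨
    (fromℕ 2 * f (suc m)) * l n + (fromℕ 2 * l (suc m)) * f n
      ≡⟨ solve 5 (λ t f l F L → (t :* f) :* L :+ (t :* l) :* F := t :* (f :* L :+ l :* F))
           refl (fromℕ 2) (f (suc m)) (l (suc m)) (f n) (l n) ⟩
    fromℕ 2 * (f (suc m) * l n + l (suc m) * f n)   ∎)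

  2l-+ : ∀ m n → fromℕ 2 * l (m ℕ.+ n) ≡ l m * l n + fromℕ 5 * (f m * f n)
  2l-+ zero    n = solve 2 (λ F L → con (fromℕ 2) :* L := con (fromℕ 2) :* L :+ con (fromℕ 5) :* (con 0# :* F)) refl (f n) (l n)
  2l-+ (suc m) n = *-cancelˡ (fromℕ 2) (λ ()) (begin
    fromℕ 2 * (fromℕ 2 * l (suc m ℕ.+ n))           ≡⟨ cong (fromℕ 2 *_) (2l-suc (m ℕ.+ n)) ⟩
    fromℕ 2 * (l (m ℕ.+ n) + fromℕ 5 * f (m ℕ.+ n))
      ≡⟨ solve 2 (λ L F → con (fromℕ 2) :* (L :+ con (fromℕ 5) :* F)
             := con (fromℕ 2) :* L :+ con (fromℕ 5) :* (con (fromℕ 2) :* F)) refl (l (m ℕ.+ n)) (f (m ℕ.+ n)) ⟩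
    fromℕ 2 * l (m ℕ.+ n) + fromℕ 5 * (fromℕ 2 * f (m ℕ.+ n))
      ≡⟨ cong₂ (λ u v → u + fromℕ 5 * v) (2l-+ m n) (2f-+ m n) ⟩
    (l m * l n + fromℕ 5 * (f m * f n)) + fromℕ 5 * (f m * l n + l m * f n)
      ≡⟨ solve 4 (λ f l F L → (l :* L :+ con (fromℕ 5) :* (f :* F)) :+ con (fromℕ 5) :* (f :* L :+ l :* F)
                           := (l :+ con (fromℕ 5) :* f) :* L :+ con (fromℕ 5) :* ((f :+ l) :* F)) refl (f m) (l m) (f n) (l n) ⟩
    (l m + fromℕ 5 * f m) * l n + fromℕ 5 * ((f m + l m) * f n)
      ≡⟨ cong₂ (λ u v → v * l n + fromℕ 5 * (u * f n)) (2f-suc m) (2l-suc m) ⟨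
    (fromℕ 2 * l (suc m)) * l n + fromℕ 5 * ((fromℕ 2 * f (suc m)) * f n)
      ≡⟨ solve 4 (λ f l F L → (con (fromℕ 2) :* l) :* L :+ con (fromℕ 5) :* ((con (fromℕ 2) :* f) :* F)
                           := con (fromℕ 2) :* (l :* L :+ con (fromℕ 5) :* (f :* F)))
           refl (f (suc m)) (l (suc m)) (f n) (l n) ⟩
    fromℕ 2 * (l (suc m) * l n + fromℕ 5 * (f (suc m) * f n)) ∎)

f-double : ∀ n → f (2 ℕ.* n) ≡ f n * l n
f-double n = *-cancelˡ (fromℕ 2) (λ ()) (begin
  fromℕ 2 * f (2 ℕ.* n)    ≡⟨ cong (λ m → fromℕ 2 * f (n ℕ.+ m)) (ℕ.+-identityʳ n) ⟩
  fromℕ 2 * f (n ℕ.+ n)    ≡⟨ 2f-+ n n ⟩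
  f n * l n + l n * f n    ≡⟨ solve 2 (λ F L → F :* L :+ L :* F := con (fromℕ 2) :* (F :* L)) refl (f n) (l n) ⟩
  fromℕ 2 * (f n * l n)    ∎)

2l-double : ∀ n → fromℕ 2 * l (2 ℕ.* n) ≡ l n * l n + fromℕ 5 * (f n * f n)
2l-double n = trans (cong (λ m → fromℕ 2 * l (n ℕ.+ m)) (ℕ.+-identityʳ n)) (2l-+ n n)

-- The left side is the norm of Lₙ + Fₙ√5. Each shift multiplies this element by (1 + √5)/2, of norm
-- -1, so the sign alternates from the initial value 4. The factor 4 clears the halves.
l²-5f² : ∀ n → l n * l n - fromℕ 5 * (f n * f n) ≡ fromℕ 4 * (- 1#) ^ n
l²-5f² zero    = refl
l²-5f² (suc n) = *-cancelˡ (fromℕ 4) (λ ()) (begin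
  fromℕ 4 * (l (suc n) * l (suc n) - fromℕ 5 * (f (suc n) * f (suc n)))
    ≡⟨ solve 2 (λ F L → con (fromℕ 4) :* (L :* L :- con (fromℕ 5) :* (F :* F))
         := (con (fromℕ 2) :* L) :* (con (fromℕ 2) :* L) :- con (fromℕ 5) :* ((con (fromℕ 2) :* F) :* (con (fromℕ 2) :* F)))
         refl (f (suc n)) (l (suc n)) ⟩
  (fromℕ 2 * l (suc n)) * (fromℕ 2 * l (suc n)) - fromℕ 5 * ((fromℕ 2 * f (suc n)) * (fromℕ 2 * f (suc n)))
    ≡⟨ cong₂ (λ u v → u * u - fromℕ 5 * (v * v)) (2l-suc n) (2f-suc n) ⟩
  (l n + fromℕ 5 * f n) * (l n + fromℕ 5 * f n) - fromℕ 5 * ((f n + l n) * (f n + l n))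
    ≡⟨ solve 2 (λ F L → (L :+ con (fromℕ 5) :* F) :* (L :+ con (fromℕ 5) :* F) :- con (fromℕ 5) :* ((F :+ L) :* (F :+ L))
         := con (fromℕ 4) :* (con (- 1#) :* (L :* L :- con (fromℕ 5) :* (F :* F)))) refl (f n) (l n) ⟩
  fromℕ 4 * (- 1# * (l n * l n - fromℕ 5 * (f n * f n)))
    ≡⟨ cong (λ c → fromℕ 4 * (- 1# * c)) (l²-5f² n) ⟩
  fromℕ 4 * (- 1# * (fromℕ 4 * (- 1#) ^ n))
    ≡⟨ solve 1 (λ s → con (fromℕ 4) :* (con (- 1#) :* (con (fromℕ 4) :* s))
         := con (fromℕ 4) :* (con (fromℕ 4) :* (con (- 1#) :* s))) refl ((- 1#) ^ n) ⟩
  fromℕ 4 * (fromℕ 4 * (- 1#) ^ suc n) ∎)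

0<fib-suc : ∀ n → 0 ℕ.< fib (suc n)
0<fib-suc zero    = s≤s z≤n
0<fib-suc (suc n) = ℕ.≤-trans (0<fib-suc n) (ℕ.m≤m+n (fib (suc n)) (fib n))

f-suc≢0 : ∀ n → f (suc n) ≢ 0#
f-suc≢0 n eq = ℕ.<⇒≢ (0<fib-suc n) (sym (ℤ.+-injective (fromℤ≡0⇒≡0 (+ fib (suc n)) eq)))

-- From natural to integer indices.

fromℤ-F-neg : ∀ m → fromℤ (F -[1+ m ]) ≡ (- 1#) ^ m * f (suc m)
fromℤ-F-neg m = trans (fromℤ-homo-* ((ℤ.- + 1) ℤ.^ m) (+ fib (suc m)))
  (cong (_* f (suc m)) (fromℤ-homo-^ (ℤ.- + 1) m))

fromℤ-L-neg : ∀ m → fromℤ (L -[1+ m ]) ≡ (- 1#) ^ suc m * l (suc m)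
fromℤ-L-neg m = trans (fromℤ-homo-* ((ℤ.- + 1) ℤ.^ suc m) (+ luc (suc m)))
  (cong (_* l (suc m)) (fromℤ-homo-^ (ℤ.- + 1) (suc m)))

-- Fₚ, Lₚ and F₂ₚ enter the identity only through even powers, so the sign attached to a negative
-- index disappears on squaring.
[sx]²≡x² : ∀ s x {z} → s * s ≡ 1# → z ≡ s * x → z * z ≡ x * x
[sx]²≡x² s x s²≡1 refl = begin
  s * x * (s * x)   ≡⟨ solve 2 (λ s x → s :* x :* (s :* x) := s :* s :* (x :* x)) refl s x ⟩
  s * s * (x * x)   ≡⟨ cong (_* (x * x)) s²≡1 ⟩
  1# * (x * x)      ≡⟨ *-identityˡ (x * x) ⟩
  x * x             ∎

F² : ∀ p → fromℤ (F p) * fromℤ (F p) ≡ f ℤ.∣ p ∣ * f ℤ.∣ p ∣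
F² (+ n)    = refl
F² -[1+ m ] = [sx]²≡x² ((- 1#) ^ m) (f (suc m)) (-1^n*-1^n≡1 m) (fromℤ-F-neg m)

L² : ∀ p → fromℤ (L p) * fromℤ (L p) ≡ l ℤ.∣ p ∣ * l ℤ.∣ p ∣
L² (+ n)    = refl
L² -[1+ m ] = [sx]²≡x² ((- 1#) ^ suc m) (l (suc m)) (-1^n*-1^n≡1 (suc m)) (fromℤ-L-neg m)

L-double : ∀ p → fromℤ (L (+ 2 ℤ.* p)) ≡ l (2 ℕ.* ℤ.∣ p ∣)
L-double (+ n)    = cong (λ i → fromℤ (L i)) (sym (ℤ.pos-* 2 n))
L-double -[1+ m ] = begin
  -- The product of `+ 2` and `-[1+ m ]` computes to the negative integer with predecessor
  -- `m + suc (m + 0)`, whose successor is `2 * suc m`; the sign therefore has an even exponent.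
  fromℤ (L (+ 2 ℤ.* -[1+ m ]))                  ≡⟨ fromℤ-L-neg (m ℕ.+ suc (m ℕ.+ 0)) ⟩
  (- 1#) ^ (2 ℕ.* suc m) * l (2 ℕ.* suc m)      ≡⟨ cong (_* l (2 ℕ.* suc m)) even-power ⟩
  1# * l (2 ℕ.* suc m)                          ≡⟨ *-identityˡ _ ⟩
  l (2 ℕ.* suc m)                               ∎
  where
  even-power : (- 1#) ^ (2 ℕ.* suc m) ≡ 1#
  even-power = begin
    (- 1#) ^ (suc m ℕ.+ (suc m ℕ.+ 0))  ≡⟨ cong (λ i → (- 1#) ^ (suc m ℕ.+ i)) (ℕ.+-identityʳ (suc m)) ⟩
    (- 1#) ^ (suc m ℕ.+ suc m)          ≡⟨ ^-distribˡ-+-* (- 1#) (suc m) (suc m) ⟩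
    (- 1#) ^ suc m * (- 1#) ^ suc m     ≡⟨ -1^n*-1^n≡1 (suc m) ⟩
    1#                                  ∎

-- Squares depend only on |p|, where `f-double` applies.
F-double² : ∀ p → let F₂ₚ = fromℤ (F (+ 2 ℤ.* p)) in
  F₂ₚ * F₂ₚ ≡ (fromℤ (F p) * fromℤ (F p)) * (fromℤ (L p) * fromℤ (L p))
F-double² p = begin
  fromℤ (F (+ 2 ℤ.* p)) * fromℤ (F (+ 2 ℤ.* p))   ≡⟨ F² (+ 2 ℤ.* p) ⟩
  f ℤ.∣ + 2 ℤ.* p ∣ * f ℤ.∣ + 2 ℤ.* p ∣             ≡⟨ cong (λ m → f m * f m) (ℤ.abs-* (+ 2) p) ⟩
  f (2 ℕ.* q) * f (2 ℕ.* q)                       ≡⟨ cong (λ u → u * u) (f-double q) ⟩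
  f q * l q * (f q * l q)
    ≡⟨ solve 2 (λ F L → F :* L :* (F :* L) := (F :* F) :* (L :* L)) refl (f q) (l q) ⟩
  (f q * f q) * (l q * l q)                       ≡⟨ cong₂ _*_ (F² p) (L² p) ⟨
  (fromℤ (F p) * fromℤ (F p)) * (fromℤ (L p) * fromℤ (L p)) ∎
  where q = ℤ.∣ p ∣

F-double≢0 : ∀ p → p ≢ 0ℤ → fromℤ (F (+ 2 ℤ.* p)) ≢ 0#
F-double≢0 (+ zero)  p≢0    = contradiction refl p≢0
F-double≢0 (+ suc n) _      = f-suc≢0 (n ℕ.+ suc (n ℕ.+ 0))
F-double≢0 -[1+ m ]  _   eq = 
  x*y≢0 ((- 1#) ^ k) (f (suc k)) (x^n≢0 (- 1#) k λ ()) (f-suc≢0 k)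
        (trans (sym (fromℤ-F-neg k)) eq)
  where k = m ℕ.+ suc (m ℕ.+ 0)

-- For negative `p` the closed term `(- 1#) ⁻¹` evaluates to `- 1#`.
-1^ℤ : ∀ p → (- 1#) ^ℤ p ≡ (- 1#) ^ ℤ.∣ p ∣
-1^ℤ (+ n)    = refl
-1^ℤ -[1+ m ] = refl

-- Evaluation of the sum through the closed form of `odd`.

theorem19 : (n : ℕ) (p : ℤ) → p ≢ 0ℤ →
    (∑[1≤ k ≤ n ]
      ((- 1#) ^ (n ∸ k)
        * (fromℕ k / fromℕ (n ℕ.+ k))
        * fromℕ ((n ℕ.+ k) C (n ∸ k))
        * ((fromℕ 2 * fromℤ (L (+ 2 ℤ.* p))) / (√5 * fromℤ (F (+ 2 ℤ.* p)))) ^ (2 ℕ.* k)))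
    ≡ (- 1#) ^ℤ p
      * ((fromℤ (L (+ 2 ℤ.* p))
            * (fromℤ (L p) ^ (4 ℕ.* n) - fromℕ 5 ^ (2 ℕ.* n) * fromℤ (F p) ^ (4 ℕ.* n)))
         / (fromℕ 4 * (√5 * fromℤ (F (+ 2 ℤ.* p))) ^ (2 ℕ.* n)))
theorem19 n p p≢0 = begin
  (∑[1≤ k ≤ n ] ((- 1#) ^ (n ∸ k) * (fromℕ k / fromℕ (n ℕ.+ k)) * fromℕ ((n ℕ.+ k) C (n ∸ k)) * z ^ (2 ℕ.* k)))
    ≡⟨ ∑₁-cong n summand ⟩
  (∑[1≤ k ≤ n ] (fromℚ ½ * oddTerm n (ℕ.pred k)))
    ≡⟨ ∑₁-*-distribˡ n (fromℚ ½) _ ⟩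
  fromℚ ½ * odd n
    -- Multiplying by the whole denominator `E` reduces the claim to the division-free `closed`.
    ≡⟨ *-cancelˡ E E≢0 scaled ⟩
  ε * ((ℓ₂ * (ℓ ^ (4 ℕ.* n) - fromℕ 5 ^ (2 ℕ.* n) * ϕ ^ (4 ℕ.* n))) / E) ∎
  where
  ε  = (- 1#) ^ℤ p
  ℓ  = fromℤ (L p)
  ϕ  = fromℤ (F p)
  ℓ₂ = fromℤ (L (+ 2 ℤ.* p))
  D  = √5 * fromℤ (F (+ 2 ℤ.* p))
  z  = (fromℕ 2 * ℓ₂) / D
  -- With `a` = Lₚ², `b` = 5Fₚ² and d = `D ^ 2`, the ratio a / b is t² for t = Lₚ / (√5 Fₚ).
  a  = ℓ * ℓ
  b  = fromℕ 5 * (ϕ * ϕ)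
  E  = fromℕ 4 * D ^ (2 ℕ.* n)
  Q  = ℓ₂ * (ℓ ^ (4 ℕ.* n) - fromℕ 5 ^ (2 ℕ.* n) * ϕ ^ (4 ℕ.* n))
  open Chebyshev (z ^ 2)

  D≢0 : D ≢ 0#
  D≢0 = x*y≢0 √5 (fromℤ (F (+ 2 ℤ.* p))) (λ ()) (F-double≢0 p p≢0)

  E≢0 : E ≢ 0#
  E≢0 = x*y≢0 (fromℕ 4) (D ^ (2 ℕ.* n)) (λ ()) (x^n≢0 D (2 ℕ.* n) D≢0)

  summand : ∀ j → j ℕ.< n →
    (- 1#) ^ (n ∸ suc j) * (fromℕ (suc j) / fromℕ (n ℕ.+ suc j))
      * fromℕ ((n ℕ.+ suc j) C (n ∸ suc j)) * z ^ (2 ℕ.* suc j)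
    ≡ fromℚ ½ * oddTerm n j
  -- The hypothesis `j < n` is by definition `suc j ≤ n`, that is, k ≤ n.
  summand j k≤n = begin
    (- 1#) ^ (n ∸ suc j) * r * c * z ^ (2 ℕ.* suc j)
      ≡⟨ cong₂ (λ s t → s * r * c * t) (-1^[n∸k] k≤n) (sym (^-*-assoc z 2 (suc j))) ⟩
    s * r * c * (z ^ 2) ^ suc j
      ≡⟨ cong (_* (z ^ 2) ^ suc j) (*-assoc s r c) ⟩
    s * (r * c) * (z ^ 2) ^ suc j
      ≡⟨ cong (λ t → s * t * (z ^ 2) ^ suc j) (k/[n+k]*[n+k]C[n∸k] n j k≤n) ⟩
    s * (fromℚ ½ * A) * (z ^ 2) ^ suc j
      ≡⟨ solve 4 (λ s h A y → s :* (h :* A) :* y := h :* (s :* A :* y)) refl s (fromℚ ½) A ((z ^ 2) ^ suc j) ⟩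
    fromℚ ½ * oddTerm n j ∎
    where
    r = fromℕ (suc j) / fromℕ (n ℕ.+ suc j)
    c = fromℕ ((n ℕ.+ suc j) C (n ∸ suc j))
    s = (- 1#) ^ n * (- 1#) ^ suc j
    A = fromℕ ((n ℕ.+ j) C suc (2 ℕ.* j))

  a+b≡2ℓ₂ : a + b ≡ fromℕ 2 * ℓ₂
  a+b≡2ℓ₂ = begin
    a + b
      ≡⟨ cong₂ (λ u v → u + fromℕ 5 * v) (L² p) (F² p) ⟩
    l ℤ.∣ p ∣ * l ℤ.∣ p ∣ + fromℕ 5 * (f ℤ.∣ p ∣ * f ℤ.∣ p ∣)
      ≡⟨ 2l-double ℤ.∣ p ∣ ⟨
    fromℕ 2 * l (2 ℕ.* ℤ.∣ p ∣)
      ≡⟨ cong (fromℕ 2 *_) (L-double p) ⟨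
    fromℕ 2 * ℓ₂ ∎

  a-b≡4ε : a - b ≡ fromℕ 4 * ε
  a-b≡4ε = begin
    a - b
      ≡⟨ cong₂ (λ u v → u - fromℕ 5 * v) (L² p) (F² p) ⟩
    l ℤ.∣ p ∣ * l ℤ.∣ p ∣ - fromℕ 5 * (f ℤ.∣ p ∣ * f ℤ.∣ p ∣)
      ≡⟨ l²-5f² ℤ.∣ p ∣ ⟩
    fromℕ 4 * (- 1#) ^ ℤ.∣ p ∣
      ≡⟨ cong (fromℕ 4 *_) (-1^ℤ p) ⟨
    fromℕ 4 * ε ∎

  ε²≡1 : ε * ε ≡ 1#
  ε²≡1 = trans (cong (λ s → s * s) (-1^ℤ p)) (-1^n*-1^n≡1 ℤ.∣ p ∣)

  D²≡ab : D ^ 2 ≡ a * b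
  D²≡ab = begin
    D ^ 2
      ≡⟨ solve 1 (λ F → con √5 :* F :* (con √5 :* F :* con 1#) := con (fromℕ 5) :* (F :* F))
           refl (fromℤ (F (+ 2 ℤ.* p))) ⟩
    fromℕ 5 * (fromℤ (F (+ 2 ℤ.* p)) * fromℤ (F (+ 2 ℤ.* p)))
      ≡⟨ cong (fromℕ 5 *_) (F-double² p) ⟩
    fromℕ 5 * ((ϕ * ϕ) * (ℓ * ℓ))
      ≡⟨ solve 3 (λ c u v → c :* (u :* v) := v :* (c :* u)) refl (fromℕ 5) (ϕ * ϕ) (ℓ * ℓ) ⟩
    a * b ∎

  D²z²≡[a+b]² : D ^ 2 * z ^ 2 ≡ (a + b) * (a + b)
  D²z²≡[a+b]² = begin
    D ^ 2 * z ^ 2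
      ≡⟨ solve 3 (λ D D′ X → D :* (D :* con 1#) :* (X :* D′ :* (X :* D′ :* con 1#))
           := (D :* D′) :* (D :* D′) :* (X :* X)) refl D (D ⁻¹) (fromℕ 2 * ℓ₂) ⟩
    (D * D ⁻¹) * (D * D ⁻¹) * ((fromℕ 2 * ℓ₂) * (fromℕ 2 * ℓ₂))
      ≡⟨ cong₂ (λ i w → i * i * (w * w)) (*-inverseʳ D D≢0) (sym a+b≡2ℓ₂) ⟩
    1# * ((a + b) * (a + b))
      ≡⟨ *-identityˡ _ ⟩
    (a + b) * (a + b) ∎

  a²ⁿ : (a * a) ^ n ≡ ℓ ^ (4 ℕ.* n)
  a²ⁿ = trans (cong (_^ n) (solve 1 (λ x → x :* x :* (x :* x) := x :* (x :* (x :* (x :* con 1#)))) refl ℓ))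
              (^-*-assoc ℓ 4 n)

  b²ⁿ : (b * b) ^ n ≡ fromℕ 5 ^ (2 ℕ.* n) * ϕ ^ (4 ℕ.* n)
  b²ⁿ = begin
    (b * b) ^ n
      ≡⟨ cong (_^ n) (solve 2 (λ c x → c :* (x :* x) :* (c :* (x :* x))
           := c :* (c :* con 1#) :* (x :* (x :* (x :* (x :* con 1#))))) refl (fromℕ 5) ϕ) ⟩
    (fromℕ 5 ^ 2 * ϕ ^ 4) ^ n
      ≡⟨ ^-distribʳ-* (fromℕ 5 ^ 2) (ϕ ^ 4) n ⟩
    (fromℕ 5 ^ 2) ^ n * (ϕ ^ 4) ^ n
      ≡⟨ cong₂ _*_ (^-*-assoc (fromℕ 5) 2 n) (^-*-assoc ϕ 4 n) ⟩
    fromℕ 5 ^ (2 ℕ.* n) * ϕ ^ (4 ℕ.* n) ∎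

  closed : D ^ (2 ℕ.* n) * odd n * (fromℕ 4 * ε) ≡ fromℕ 2 * Q
  closed = begin
    D ^ (2 ℕ.* n) * odd n * (fromℕ 4 * ε)
      ≡⟨ cong₂ (λ u v → u * odd n * v) (^-*-assoc D 2 n) a-b≡4ε ⟨
    (D ^ 2) ^ n * odd n * (a - b)
      ≡⟨ ClosedForm.odd-closed a b (D ^ 2) D²≡ab D²z²≡[a+b]² n ⟩
    (a + b) * ((a * a) ^ n - (b * b) ^ n)
      ≡⟨ cong₂ _*_ a+b≡2ℓ₂ (cong₂ _-_ a²ⁿ b²ⁿ) ⟩
    fromℕ 2 * ℓ₂ * (ℓ ^ (4 ℕ.* n) - fromℕ 5 ^ (2 ℕ.* n) * ϕ ^ (4 ℕ.* n))
      ≡⟨ *-assoc (fromℕ 2) ℓ₂ _ ⟩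
    fromℕ 2 * Q ∎

  scaled : E * (fromℚ ½ * odd n) ≡ E * (ε * (Q / E))
  scaled = begin
    E * (fromℚ ½ * odd n)
      ≡⟨ solve 2 (λ d o → con (fromℕ 4) :* d :* (con (fromℚ ½) :* o)
           := con 1# :* (con (fromℚ ½) :* (d :* o :* con (fromℕ 4)))) refl (D ^ (2 ℕ.* n)) (odd n) ⟩
    1# * (fromℚ ½ * (D ^ (2 ℕ.* n) * odd n * fromℕ 4))
      -- The 1 becomes ε²: one ε completes the factor 4ε = a - b that `closed` needs, the other is
      -- the sign (-1)ᵖ on the right-hand side.
      ≡⟨ cong (_* (fromℚ ½ * (D ^ (2 ℕ.* n) * odd n * fromℕ 4))) ε²≡1 ⟨
    ε * ε * (fromℚ ½ * (D ^ (2 ℕ.* n) * odd n * fromℕ 4))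
      ≡⟨ solve 3 (λ e x c → e :* e :* (con (fromℚ ½) :* (x :* c)) := e :* con (fromℚ ½) :* (x :* (c :* e)))
           refl ε (D ^ (2 ℕ.* n) * odd n) (fromℕ 4) ⟩
    ε * fromℚ ½ * (D ^ (2 ℕ.* n) * odd n * (fromℕ 4 * ε))
      ≡⟨ cong (ε * fromℚ ½ *_) closed ⟩
    ε * fromℚ ½ * (fromℕ 2 * Q)
      ≡⟨ solve 2 (λ e Q → e :* con (fromℚ ½) :* (con (fromℕ 2) :* Q) := con 1# :* (e :* Q)) refl ε Q ⟩
    1# * (ε * Q)
      ≡⟨ cong (_* (ε * Q)) (*-inverseʳ E E≢0) ⟨
    E * E ⁻¹ * (ε * Q)
      ≡⟨ solve 4 (λ E E′ e Q → E :* E′ :* (e :* Q) := E :* (e :* (Q :* E′))) refl E (E ⁻¹) ε Q ⟩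
    E * (ε * (Q / E)) ∎
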